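{- For every instance $\mathcal{I}$ of the oblivious knapsack problem, the sequence $\Pi=\textsc{Universal}(\mathcal{I})$ output by the algorithm $\textsc{Universal}$ is a universal policy of robustness factor $2$; that is, $v(\textsc{Opt}(\mathcal{I},C))\le 2\cdot v(\Pi(C))$ for every capacity $C$.
   Context: An instance of the oblivious knapsack problem is a finite set $\mathcal{I}$ of $n$ items; each item $i$ has a value $v(i)\in\mathbb{Q}_{\ge 0}$ and a size $l(i)\in\mathbb{Q}_{>0}$. For $S\subseteq\mathcal{I}$ put $v(S)=\sum_{i\in S}v(i)$ and $l(S)=\sum_{i\in S}l(i)$. For a capacity $C\geq 0$, $\textsc{Opt}(\mathcal{I},C)$ denotes a subset $S\subseteq\mathcal{I}$ with $l(S)\le C$ of maximum value. A universal policy is a permutation $\Pi=(\Pi_1,\dots,\Pi_n)$ of the items. Its packing $\Pi(C)\subseteq\mathcal{I}$ for capacity $C$ is obtained by starting with the empty set and considering the items in the order $\Pi_1,\dots,\Pi_n$, adding an item if and only if its size does not exceed the remaining capacity (an item that does not fit is discarded and packing continues). The policy is $\alpha$-robust (has robustness factor $\alpha$), $\alpha\ge1$, if $v(\textsc{Opt}(\mathcal{I},C))\le\alpha\, v(\Pi(C))$ for all capacities $C$. Density order: $d(i)=v(i)/l(i)$. A bijection (tie-breaking index) $t:\mathcal{I}\to\{1,\dots,n\}$ is fixed. Write $\tilde d(i)\succ\tilde d(j)$ iff $d(i)>d(j)$, or $d(i)=d(j)$ and $t(i)>t(j)$. Swap items: for a capacity $C$, let $D=(D_1,D_2,\dots)$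 be the items of size at most $C$ sorted decreasingly with respect to $\tilde d$, let $k=\max\{j\mid l(\{D_1,\dots,D_j\})\le C\}$, $P=\{D_1,\dots,D_k\}$, and $s=D_{k+1}$ (if it exists). The algorithm $\textsc{MGreedy}(\mathcal{I},C)$ returns $P$ if $v(P)\ge v(s)$ or if $s$ does not exist, and returns $\{s\}$ otherwise. In the latter case $s$ is called a swap item for capacity $C$. An item is a swap item if it is a swap item for some capacity $C$. Algorithm $\textsc{Universal}(\mathcal{I})$: let $L=(L_1,\dots,L_n)$ be the items sorted by non-decreasing size (ties broken arbitrarily). Start with the empty sequence $\Pi^{(0)}$. For $r=1,\dots,n$: if $L_r$ is a swap item, then $\Pi^{(r)}$ is obtained from $\Pi^{(r-1)}$ by inserting $L_r$ at the very front; otherwise $\Pi^{(r)}$ is obtained from $\Pi^{(r-1)}$ by inserting $L_r$ immediately in front of the first item $\Pi^{(r-1)}_j$ for which $\tilde d(\Pi^{(r-1)}_j)\succ\tilde d(L_r)$ does not hold (at the end if there is no such item). The output is $\Pi=\Pi^{(n)}$. -}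

module Defs where

open import Data.Fin.Base as Fin using (Fin)
open import Data.Fin.Permutation using (Permutation′; _⟨$⟩ʳ_)
import Data.Fin.Properties as Fin
open import Data.Fin.Subset using (Subset; inside; outside; ⊥)
open import Data.Fin.Subset.Properties using (_∈?_; ∉⊥)
open import Data.List.Base using (List; []; _∷_; _++_; map; concatMap; foldr; foldl; filter; take; drop; head; takeWhile; dropWhile; upTo; allFin; length)
open import Data.List.Extrema.Nat using () renaming (max to maxℕ)
open import Data.List.Membership.Propositional using (_∈_; lose; find)
open import Data.List.Membership.Propositional.Properties
open import Data.List.Properties using (filter-none) renaming (≡-dec to List-≡-dec)
open import Data.List.Relation.Binary.Permutation.Propositional using (_↭_)
open import Data.List.Relation.Unary.All as All using ()
open import Data.List.Relation.Unary.Any using (Any; here; there; any?)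
open import Data.List.Relation.Unary.Linked using (Linked)
import Data.List.Sort as Sort
open import Data.Maybe.Base using (Maybe; just; nothing)
open import Data.Nat.Base as ℕ using (ℕ; zero; suc)
open import Data.Product.Base using (∃; _×_; _,_; proj₁; proj₂)
open import Data.Rational.Base using (ℚ; 0ℚ; _+_; _-_; _*_; _÷_; _≤_; _<_; _>_; >-nonZero)
open import Data.Rational.Properties using (_≤?_; _<?_; _≟_; ≤-trans; <-trans; <-cmp; ≤-decTotalOrder)
open import Data.Sum.Base using (_⊎_; inj₁; inj₂)
import Data.Sum.Properties as Sum
open import Data.Vec.Base using ([]; _∷_)
open import Function.Base using (_∘_)
open import Function.Bundles using (Inverse)
open import Level using (0ℓ)
open import Relation.Binary.Bundles using (DecTotalOrder)
import Relation.Binary.Construct.StrictToNonStrict as ToNonStrict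
open import Relation.Binary.Definitions using (Transitive; Trichotomous; tri<; tri≈; tri>)
open import Relation.Binary.Structures using (IsStrictTotalOrder)
open import Relation.Binary.Structures.Biased using (isStrictTotalOrderᶜ)
open import Relation.Binary.PropositionalEquality using (_≡_; refl; sym; trans; cong; subst; isEquivalence)
open import Relation.Nullary using (Dec; yes; no; contradiction)
open import Relation.Nullary.Decidable using (map′; _×-dec_; _⊎-dec_)
open import Relation.Unary using (Decidable)

open import Data.List.Extrema (DecTotalOrder.totalOrder ≤-decTotalOrder) using (max; argmax; argmax-sel; argmax-all; f[xs]≤f[argmax]; xs≤max; ⊥≤max; max≤v⁺)

-- The n items are the elements of Fin n.

record Instance (n : ℕ) : Set where
  field
    v        : Fin n → ℚ
    l        : Fin n → ℚ
    v-nonNeg : ∀ i → 0ℚ ≤ v i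
    l-pos    : ∀ i → 0ℚ < l i

-- Σ_{i ∈ xs} f(i).  Packings and policies are lists without repetitions, so
-- on them this is the sum over the set of their entries.

total : ∀ {n} → (Fin n → ℚ) → List (Fin n) → ℚ
total f = foldr (λ i s → f i + s) 0ℚ

elements : ∀ {n} → Subset n → List (Fin n)
elements S = filter (_∈? S) (allFin _)

module _ {n : ℕ} (I : Instance n) where
  open Instance I

  record IsOpt (C : ℚ) (S : Subset n) : Set where
    field
      fits    : total l (elements S) ≤ C
      maximal : ∀ T → total l (elements T) ≤ C →
                total v (elements T) ≤ total v (elements S)

  IsPolicy : List (Fin n) → Set
  IsPolicy Π = Π ↭ allFin n

  -- C is the remaining capacity.

  packing : List (Fin n) → ℚ → List (Fin n)
  packing []      C = []
  packing (i ∷ Π) C with l i ≤? C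
  ... | yes _ = i ∷ packing Π (C - l i)
  ... | no  _ = packing Π C

  -- Stated for every optimal packing; opt-exists below provides one.
  -- Rational capacities lose nothing: a capacity is only ever compared with
  -- rational sums of sizes.

  Robust : ℚ → List (Fin n) → Set
  Robust α Π = ∀ C → 0ℚ ≤ C → ∀ S → IsOpt C S →
               total v (elements S) ≤ α * total v (packing Π C)

  density : Fin n → ℚ
  density i = _÷_ (v i) (l i) {{>-nonZero (l-pos i)}}

  BySize : List (Fin n) → Set
  BySize = Linked (λ i j → l i ≤ l j)

module _ {n : ℕ} (I : Instance n) (t : Permutation′ n) where
  open Instance I

  infix 4 _≻_ _≻?_

  _≻_ : Fin n → Fin n → Set
  i ≻ j = density I i > density I j
        ⊎ (density I i ≡ density I j × (t ⟨$⟩ʳ i) Fin.> (t ⟨$⟩ʳ j))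

  _≻?_ : ∀ i j → Dec (i ≻ j)
  i ≻? j = (density I j <? density I i)
     ⊎-dec ((density I i ≟ density I j) ×-dec ((t ⟨$⟩ʳ j) Fin.<? (t ⟨$⟩ʳ i)))

  ≻-trans : Transitive _≻_
  ≻-trans {i} {j} {k} (inj₁ p) (inj₁ q) =
    inj₁ (<-trans {density I k} {density I j} {density I i} q p)
  ≻-trans {i} (inj₁ p) (inj₂ (e , _)) = inj₁ (subst (_< density I i) e p)
  ≻-trans {k = k} (inj₂ (e , _)) (inj₁ q) = inj₁ (subst (density I k <_) (sym e) q)
  ≻-trans (inj₂ (e , p)) (inj₂ (e′ , q)) = inj₂ (trans e e′ , Fin.<-trans q p)

  ≻-cmp : Trichotomous _≡_ _≻_
  ≻-cmp i j with <-cmp (density I j) (density I i)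
  ... | tri< p e≢ q≮ = tri< (inj₁ p) (λ { refl → e≢ refl })
                       (λ { (inj₁ q) → q≮ q ; (inj₂ (e , _)) → e≢ e })
  ... | tri> p≮ e≢ q = tri> (λ { (inj₁ p) → p≮ p ; (inj₂ (e , _)) → e≢ (sym e) })
                       (λ { refl → e≢ refl }) (inj₁ q)
  ... | tri≈ p≮ e q≮ with Fin.<-cmp (t ⟨$⟩ʳ j) (t ⟨$⟩ʳ i)
  ...   | tri< p e≢ q≮′ = tri< (inj₂ (sym e , p)) (λ { refl → e≢ refl })
                          (λ { (inj₁ q) → q≮ q ; (inj₂ (_ , q)) → q≮′ q })
  ...   | tri> p≮′ e≢ q = tri> (λ { (inj₁ p) → p≮ p ; (inj₂ (_ , p)) → p≮′ p })
                          (λ { refl → e≢ refl }) (inj₂ (e , q))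
  ...   | tri≈ p≮′ e′ q≮′ = tri≈
    (λ { (inj₁ p) → p≮ p ; (inj₂ (_ , p)) → p≮′ p })
    (trans (sym (Inverse.strictlyInverseʳ t i))
      (trans (cong (Inverse.from t) (sym e′)) (Inverse.strictlyInverseʳ t j)))
    (λ { (inj₁ q) → q≮ q ; (inj₂ (_ , q)) → q≮′ q })

  ≻-isStrictTotalOrder : IsStrictTotalOrder _≡_ _≻_
  ≻-isStrictTotalOrder = isStrictTotalOrderᶜ record
    { isEquivalence = isEquivalence ; trans = ≻-trans ; compare = ≻-cmp }

  -- The order relation of this bundle is "i ≻ j or i ≡ j", so sorting with
  -- respect to it is sorting decreasingly.

  ≽-decTotalOrder : DecTotalOrder 0ℓ 0ℓ 0ℓ
  ≽-decTotalOrder = record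
    { isDecTotalOrder = ToNonStrict.isDecTotalOrder _≡_ _≻_ ≻-isStrictTotalOrder }

  candidates : ℚ → List (Fin n)
  candidates C = Sort.sort ≽-decTotalOrder (filter (λ i → l i ≤? C) (allFin n))

  fittingLengths : ℚ → List (Fin n) → List ℕ
  fittingLengths C D = filter (λ j → total l (take j D) ≤? C) (upTo (suc (length D)))

  prefixLength : ℚ → List (Fin n) → ℕ
  prefixLength C D = maxℕ 0 (fittingLengths C D)

  -- inj₁ P stands for the packing P, inj₂ s for the packing {s}.

  choose : List (Fin n) → Maybe (Fin n) → List (Fin n) ⊎ Fin n
  choose P nothing = inj₁ P
  choose P (just s) with v s ≤? total v P
  ... | yes _ = inj₁ P
  ... | no  _ = inj₂ s

  mgreedy : ℚ → List (Fin n) ⊎ Fin n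
  mgreedy C = choose (take k D) (head (drop k D))
    where
    D = candidates C
    k = prefixLength C D

  IsSwapFor : ℚ → Fin n → Set
  IsSwapFor C s = mgreedy C ≡ inj₂ s

  IsSwap : Fin n → Set
  IsSwap s = ∃ λ C → 0ℚ ≤ C × IsSwapFor C s

  -- IsSwap is decidable: the outcome of mgreedy depends only on which of
  -- finitely many thresholds are at most C, so the capacity can be rounded
  -- down to a threshold.

  module SwapDecidable where

    filter-cong : ∀ {A : Set} {P Q : A → Set} (P? : Decidable P) (Q? : Decidable Q) →
                  ∀ xs → (∀ {x} → x ∈ xs → (P x → Q x) × (Q x → P x)) →
                  filter P? xs ≡ filter Q? xs
    filter-cong P? Q? []       h = refl
    filter-cong P? Q? (x ∷ xs) h with P? x | Q? x
    ... | yes p | yes q = cong (x ∷_) (filter-cong P? Q? xs (h ∘ there))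
    ... | no  _ | no  _ = filter-cong P? Q? xs (h ∘ there)
    ... | yes p | no ¬q = contradiction (proj₁ (h (here refl)) p) ¬q
    ... | no ¬p | yes q = contradiction (proj₂ (h (here refl)) q) ¬p

    round : List ℚ → ℚ → ℚ
    round ts C = max 0ℚ (filter (_≤? C) ts)

    0≤round : ∀ ts C → 0ℚ ≤ round ts C
    0≤round ts C = ⊥≤max 0ℚ (filter (_≤? C) ts)

    round-∈ : ∀ ts C → round ts C ∈ 0ℚ ∷ ts
    round-∈ ts C with argmax-sel (λ x → x) 0ℚ (filter (_≤? C) ts)
    ... | inj₁ e = here e
    ... | inj₂ m = there (proj₁ (∈-filter⁻ (_≤? C) m))

    round-≤ : ∀ ts {C} → 0ℚ ≤ C → round ts C ≤ C
    round-≤ ts {C} 0≤C = max≤v⁺ 0≤C (All.tabulate λ m → proj₂ (∈-filter⁻ (_≤? C) {xs = ts} m))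

    round-⇔ : ∀ ts {C τ} → 0ℚ ≤ C → τ ∈ ts →
              (τ ≤ C → τ ≤ round ts C) × (τ ≤ round ts C → τ ≤ C)
    round-⇔ ts {C} 0≤C τ∈ =
      (λ τ≤C → All.lookup (xs≤max 0ℚ (filter (_≤? C) ts)) (∈-filter⁺ (_≤? C) τ∈ τ≤C)) ,
      (λ τ≤r → ≤-trans τ≤r (round-≤ ts 0≤C))

    sizes : List ℚ
    sizes = map l (allFin n)

    candidates-round : ∀ ts {C} → (∀ i → l i ∈ ts) → 0ℚ ≤ C →
                       candidates C ≡ candidates (round ts C)
    candidates-round ts l∈ 0≤C = cong (Sort.sort ≽-decTotalOrder)
      (filter-cong (λ i → l i ≤? _) (λ i → l i ≤? _) (allFin n) (λ {i} _ → round-⇔ ts 0≤C (l∈ i)))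

    prefixSizes : List (Fin n) → List ℚ
    prefixSizes D = map (λ j → total l (take j D)) (upTo (suc (length D)))

    thresholds : List ℚ
    thresholds = sizes ++ concatMap (prefixSizes ∘ candidates) (0ℚ ∷ sizes)

    l∈sizes : ∀ i → l i ∈ sizes
    l∈sizes i = ∈-map⁺ l (∈-allFin i)

    prefix∈ : ∀ {C} → 0ℚ ≤ C → ∀ {j} → j ∈ upTo (suc (length (candidates C))) →
              total l (take j (candidates C)) ∈ thresholds
    prefix∈ {C} 0≤C {j} j∈ = ∈-++⁺ʳ sizes (∈-concatMap⁺ (prefixSizes ∘ candidates)
      (lose (round-∈ sizes C)
        (subst (λ D → total l (take j (candidates C)) ∈ prefixSizes D)
          (candidates-round sizes l∈sizes 0≤C) (∈-map⁺ _ j∈))))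

    prefixLength-cong : ∀ {C C′ D} →
      (∀ {j} → j ∈ upTo (suc (length D)) →
        (total l (take j D) ≤ C → total l (take j D) ≤ C′) ×
        (total l (take j D) ≤ C′ → total l (take j D) ≤ C)) →
      prefixLength C D ≡ prefixLength C′ D
    prefixLength-cong {C} {C′} {D} h = cong (maxℕ 0)
      (filter-cong (λ j → total l (take j D) ≤? C) (λ j → total l (take j D) ≤? C′)
        (upTo (suc (length D))) h)

    mgreedy-cong : ∀ {C C′} → candidates C ≡ candidates C′ →
                   prefixLength C (candidates C) ≡ prefixLength C′ (candidates C) →
                   mgreedy C ≡ mgreedy C′
    mgreedy-cong eD ek rewrite sym eD | ek = refl

    mgreedy-round : ∀ {C} → 0ℚ ≤ C → mgreedy C ≡ mgreedy (round thresholds C)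
    mgreedy-round 0≤C = mgreedy-cong
      (candidates-round thresholds (λ i → ∈-++⁺ˡ (l∈sizes i)) 0≤C)
      (prefixLength-cong λ j∈ → round-⇔ thresholds 0≤C (prefix∈ 0≤C j∈))

  isSwap? : Decidable IsSwap
  isSwap? s = map′ from to (any? swapFor? (0ℚ ∷ thresholds))
    where
    open SwapDecidable
    SwapFor : ℚ → Set
    SwapFor C = 0ℚ ≤ C × IsSwapFor C s
    swapFor? : Decidable SwapFor
    swapFor? C = (0ℚ ≤? C) ×-dec Sum.≡-dec (List-≡-dec Fin._≟_) Fin._≟_ (mgreedy C) (inj₂ s)
    from : Any SwapFor (0ℚ ∷ thresholds) → IsSwap s
    from a = let C , _ , sw = find a in C , sw
    to : IsSwap s → Any SwapFor (0ℚ ∷ thresholds)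
    to (C , 0≤C , sw) = lose (round-∈ thresholds C)
      (0≤round thresholds C , trans (sym (mgreedy-round 0≤C)) sw)

  insert : List (Fin n) → Fin n → List (Fin n)
  insert Π i with isSwap? i
  ... | yes _ = i ∷ Π
  ... | no  _ = takeWhile (_≻? i) Π ++ i ∷ dropWhile (_≻? i) Π

  -- The argument is the list of items by non-decreasing size.

  universal : List (Fin n) → List (Fin n)
  universal = foldl insert []

subsets : ∀ n → List (Subset n)
subsets zero    = [] ∷ []
subsets (suc n) = map (outside ∷_) (subsets n) ++ map (inside ∷_) (subsets n)

∈-subsets : ∀ {n} (S : Subset n) → S ∈ subsets n
∈-subsets []            = here refl
∈-subsets (outside ∷ S) = ∈-++⁺ˡ (∈-map⁺ _ (∈-subsets S))
∈-subsets (inside  ∷ S) = ∈-++⁺ʳ _ (∈-map⁺ _ (∈-subsets S))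

opt-exists : ∀ {n} (I : Instance n) C → 0ℚ ≤ C → ∃ (IsOpt I C)
opt-exists {n} I C 0≤C = argmax val ⊥ feasible , record
  { fits    = argmax-all val {P = λ S → total l (elements S) ≤ C} ⊥-fits
                (All.tabulate λ m → proj₂ (∈-filter⁻ fits? {xs = subsets n} m))
  ; maximal = λ T fits → All.lookup (f[xs]≤f[argmax] ⊥ feasible)
                (∈-filter⁺ fits? (∈-subsets T) fits)
  }
  where
  open Instance I
  val = λ S → total v (elements S)
  fits? : Decidable (λ S → total l (elements S) ≤ C)
  fits? S = total l (elements S) ≤? C
  feasible = filter fits? (subsets n)
  ⊥-fits : total l (elements {n} ⊥) ≤ C
  ⊥-fits rewrite filter-none (_∈? ⊥) {allFin n} (All.tabulate λ _ → ∉⊥) = 0≤C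

{-# OPTIONS --safe #-}

-- Universal maintains that every item x of the sequence dominates the items
-- behind it: those denser than x have total value at most v(x), and so has
-- each single swap item.  When a swap item enters at the front, MGreedy having
-- preferred it to all smaller denser items is exactly this property; when
-- another item i enters, the property is inherited from the item behind it,
-- which is neither larger nor denser than i.  Consequently, when Π packs an
-- item outside the greedy prefix P for C, that item already pays for what is
-- left of P, so v(Π(C)) ≥ v(P).  Likewise v(Π(C)) ≥ v(s) for a swap item s for
-- C, because the first item packed has at least that value.  The fractional
-- bound v(Opt) ≤ v(P) + v(s) then gives the factor 2.

module Submission where

open import Defs
open import Data.Nat.Base using (ℕ)
open import Data.Fin.Base using (Fin)
open import Data.Fin.Permutation using (Permutation′)
open import Data.Integer.Base using (+_)
open import Data.List.Base using (List; allFin)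
open import Data.List.Relation.Binary.Permutation.Propositional using (_↭_)
open import Data.Product.Base using (_×_)
open import Data.Rational.Base using (_/_)

import Data.Fin.Properties as Fin
import Data.List.Base as List
import Data.List.Extrema.Nat as ℕExtrema
import Data.List.Membership.DecPropositional as DecMembership
import Data.List.Properties as List
import Data.List.Relation.Binary.Permutation.Setoid.Properties as ↭ₛ
import Data.List.Relation.Unary.All.Properties as All
import Data.List.Relation.Unary.Unique.Propositional.Properties as Unique
import Data.List.Sort as Sort
import Data.Nat.Base as ℕ
import Data.Nat.Properties as ℕ
open import Data.List.Base using ([]; _∷_; [_]; _++_; filter; foldl; take; drop; length; takeWhile; dropWhile)
open import Data.List.Membership.Propositional using (_∈_; _∉_)
open import Data.List.Membership.Propositional.Properties
open import Data.List.Relation.Binary.Permutation.Propositional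
  using (prep; swap; ↭⇒↭ₛ; ↭-refl; ↭-sym; ↭-trans)
import Data.List.Relation.Binary.Permutation.Propositional as Perm
open import Data.List.Relation.Binary.Permutation.Propositional.Properties
  using (All-resp-↭; ∈-resp-↭; filter-↭; shift; ++⁺ʳ; ++-identityʳ)
open import Data.List.Relation.Binary.Subset.Propositional using (_⊆_)
open import Data.List.Relation.Unary.All as All using (All; []; _∷_)
open import Data.List.Relation.Unary.AllPairs using (AllPairs; []; _∷_)
open import Data.List.Relation.Unary.Any using (here; there)
open import Data.List.Relation.Unary.Linked.Properties using (Linked⇒AllPairs)
open import Data.List.Relation.Unary.Unique.Propositional using (Unique)
open import Data.Product.Base using (∃; _,_; proj₁; proj₂)
open import Data.Rational.Base using (ℚ; 0ℚ; 1ℚ; _+_; _-_; _*_; -_; 1/_; _≤_; _<_; nonNegative; positive; >-nonZero)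
open import Data.Rational.Properties hiding (_≟_)
open import Data.Rational.Solver using (module +-*-Solver)
open import Data.Sum.Base using (_⊎_; inj₁; inj₂)
open import Function.Base using (_∘_)
open import Relation.Binary.Bundles using (DecTotalOrder)
open import Relation.Binary.Definitions using (tri<; tri≈; tri>)
open import Relation.Binary.PropositionalEquality using (_≡_; refl; sym; trans; cong; cong₂; subst; setoid)
open import Relation.Nullary using (¬_; yes; no; contradiction)
open import Relation.Unary using (Decidable)

-- Lists: uniqueness, splits and insertion.

Unique-resp-↭ : ∀ {A : Set} {xs ys : List A} → xs ↭ ys → Unique xs → Unique ys
Unique-resp-↭ {A} xs↭ys = ↭ₛ.Unique-resp-↭ (setoid A) (↭⇒↭ₛ xs↭ys)

AllPairs-++⁻ˡ : ∀ {A : Set} {R : A → A → Set} xs {ys} → AllPairs R (xs ++ ys) → AllPairs R xs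
AllPairs-++⁻ˡ []       _          = []
AllPairs-++⁻ˡ (_ ∷ xs) (Rx ∷ Rxs) = All.++⁻ˡ xs Rx ∷ AllPairs-++⁻ˡ xs Rxs

AllPairs-++⁻ : ∀ {A : Set} {R : A → A → Set} {x y} xs {ys} →
               AllPairs R (xs ++ ys) → x ∈ xs → y ∈ ys → R x y
AllPairs-++⁻ (x ∷ xs) (Rx ∷ _)  (here refl) y∈ = All.lookup Rx (∈-++⁺ʳ xs y∈)
AllPairs-++⁻ (_ ∷ xs) (_ ∷ Rxs) (there x∈)  y∈ = AllPairs-++⁻ xs Rxs x∈ y∈

drop≡∷⇒take-suc : ∀ {A : Set} k (xs : List A) {x ys} → drop k xs ≡ x ∷ ys →
                  take (ℕ.suc k) xs ≡ take k xs ++ [ x ] × ℕ.suc k ℕ.≤ length xs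
drop≡∷⇒take-suc ℕ.zero    (_ ∷ _)  refl = refl , ℕ.s≤s ℕ.z≤n
drop≡∷⇒take-suc (ℕ.suc k) (y ∷ xs) eq =
  let e , k< = drop≡∷⇒take-suc k xs eq in cong (y ∷_) e , ℕ.s≤s k<

takeWhile-insert-↭ : ∀ {A : Set} {P : A → Set} (P? : Decidable P) {x} xs →
                     takeWhile P? xs ++ x ∷ dropWhile P? xs ↭ x ∷ xs
takeWhile-insert-↭ P? {x} xs = ↭-trans (shift x (takeWhile P? xs) (dropWhile P? xs))
  (prep x (Perm.↭-reflexive (List.takeWhile++dropWhile P? xs)))

-- Inequalities between rationals.

p≤p+q : ∀ p {q} → 0ℚ ≤ q → p ≤ p + q
p≤p+q p {q} 0≤q = begin
  p      ≡⟨ +-identityʳ p ⟨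
  p + 0ℚ ≤⟨ +-monoʳ-≤ p 0≤q ⟩
  p + q  ∎
  where open ≤-Reasoning

p≤q+p : ∀ p {q} → 0ℚ ≤ q → p ≤ q + p
p≤q+p p {q} 0≤q = ≤-trans (p≤p+q p 0≤q) (≤-reflexive (+-comm p q))

p+q≤r⇒q≤r-p : ∀ p q {r} → p + q ≤ r → q ≤ r - p
p+q≤r⇒q≤r-p p q {r} h = begin
  q         ≡⟨ solve 2 (λ p q → q := (p :+ q) :- p) refl p q ⟩
  p + q - p ≤⟨ +-monoˡ-≤ (- p) h ⟩
  r - p     ∎
  where open ≤-Reasoning ; open +-*-Solver

0≤q⇒p-q≤p : ∀ p {q} → 0ℚ ≤ q → p - q ≤ p
0≤q⇒p-q≤p p {q} 0≤q = begin
  p - q   ≤⟨ +-monoʳ-≤ p (neg-antimono-≤ 0≤q) ⟩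
  p + 0ℚ  ≡⟨ +-identityʳ p ⟩
  p       ∎
  where open ≤-Reasoning

p≤q⇒0≤q-p : ∀ {p q} → p ≤ q → 0ℚ ≤ q - p
p≤q⇒0≤q-p {p} {q} p≤q = begin
  0ℚ    ≡⟨ +-inverseʳ p ⟨
  p - p ≤⟨ +-monoˡ-≤ (- p) p≤q ⟩
  q - p ∎
  where open ≤-Reasoning

p≤q⇒p-q≤0 : ∀ {p q} → p ≤ q → p - q ≤ 0ℚ
p≤q⇒p-q≤0 {p} {q} p≤q = begin
  p - q ≤⟨ +-monoˡ-≤ (- q) p≤q ⟩
  q - q ≡⟨ +-inverseʳ q ⟩
  0ℚ    ∎
  where open ≤-Reasoning

-- Sums over lists of items.

module _ {n : ℕ} where

  open DecMembership (Fin._≟_ {n}) using (_∈?_)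

  total-↭ : (f : Fin n → ℚ) {xs ys : List (Fin n)} → xs ↭ ys → total f xs ≡ total f ys
  total-↭ f Perm.refl        = refl
  total-↭ f (prep x p)       = cong (λ s → f x + s) (total-↭ f p)
  total-↭ f (swap {xs} {ys} x y p) = trans
    (solve 3 (λ a b c → a :+ (b :+ c) := b :+ (a :+ c)) refl (f x) (f y) (total f xs))
    (cong (λ s → f y + (f x + s)) (total-↭ f p))
    where open +-*-Solver
  total-↭ f (Perm.trans p q) = trans (total-↭ f p) (total-↭ f q)

  total-++ : (f : Fin n → ℚ) (xs : List (Fin n)) {ys : List (Fin n)} →
             total f (xs ++ ys) ≡ total f xs + total f ys
  total-++ f []       = sym (+-identityˡ _)
  total-++ f (x ∷ xs) = trans (cong (λ s → f x + s) (total-++ f xs)) (sym (+-assoc (f x) _ _))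

  total-nonNeg : (f : Fin n → ℚ) (xs : List (Fin n)) → (∀ {x} → x ∈ xs → 0ℚ ≤ f x) → 0ℚ ≤ total f xs
  total-nonNeg f []       h = ≤-refl
  total-nonNeg f (x ∷ xs) h = ≤-trans (h (here refl)) (p≤p+q (f x) (total-nonNeg f xs (h ∘ there)))

  -- Each entry of `xs` is split off from `ys`; uniqueness keeps the other entries inside what is
  -- left. Nonnegativity is asked on `ys` alone because the surplus in `optimum-bound` may be
  -- negative outside `P`.
  total-mono-⊆ : (f : Fin n → ℚ) {xs ys : List (Fin n)} → Unique xs → xs ⊆ ys →
                 (∀ {y} → y ∈ ys → 0ℚ ≤ f y) → total f xs ≤ total f ys
  total-mono-⊆ f {[]} {ys} _ _ 0≤f = total-nonNeg f ys 0≤f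
  total-mono-⊆ f {x ∷ xs} (x∉ ∷ u) ⊆ys 0≤f with ∈-∃++ (⊆ys (here refl))
  ... | as , bs , refl = begin
    f x + total f xs         ≤⟨ +-monoʳ-≤ (f x) (total-mono-⊆ f u ⊆rest (0≤f ∘ ∈-resp-↭ (↭-sym p) ∘ there)) ⟩
    f x + total f (as ++ bs) ≡⟨ total-↭ f p ⟨
    total f (as ++ x ∷ bs)   ∎
    where
    open ≤-Reasoning
    p : as ++ x ∷ bs ↭ x ∷ as ++ bs
    p = shift x as bs
    ⊆rest : xs ⊆ as ++ bs
    ⊆rest z∈ with ∈-resp-↭ p (⊆ys (there z∈))
    ... | here refl = contradiction refl (All.lookup x∉ z∈)
    ... | there z∈′ = z∈′

  term≤total : (f : Fin n → ℚ) → (∀ i → 0ℚ ≤ f i) → ∀ {x} {xs : List (Fin n)} → x ∈ xs → f x ≤ total f xs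
  term≤total f 0≤f (here {xs = xs} refl) = p≤p+q _ (total-nonNeg f xs (λ _ → 0≤f _))
  term≤total f 0≤f (there x∈) = ≤-trans (term≤total f 0≤f x∈) (p≤q+p _ (0≤f _))

  total-filter-mono : (f : Fin n → ℚ) → (∀ i → 0ℚ ≤ f i) → {P Q : Fin n → Set} (P? : Decidable P) (Q? : Decidable Q) →
                      (∀ {i} → P i → Q i) → ∀ (xs : List (Fin n)) →
                      total f (filter P? xs) ≤ total f (filter Q? xs)
  total-filter-mono f 0≤f P? Q? P⇒Q [] = ≤-refl
  total-filter-mono f 0≤f P? Q? P⇒Q (x ∷ xs) with P? x | Q? x
  ... | yes p | yes q = +-monoʳ-≤ (f x) (total-filter-mono f 0≤f P? Q? P⇒Q xs)
  ... | yes p | no ¬q = contradiction (P⇒Q p) ¬q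
  ... | no ¬p | yes q = ≤-trans (total-filter-mono f 0≤f P? Q? P⇒Q xs) (p≤q+p _ (0≤f x))
  ... | no ¬p | no ¬q = total-filter-mono f 0≤f P? Q? P⇒Q xs

  total≤total-filter : (f : Fin n → ℚ) {P : Fin n → Set} (P? : Decidable P) (xs : List (Fin n)) →
                       (∀ {x} → x ∈ xs → ¬ P x → f x ≤ 0ℚ) → total f xs ≤ total f (filter P? xs)
  total≤total-filter f P? [] h = ≤-refl
  total≤total-filter f P? (x ∷ xs) h with P? x
  ... | yes _ = +-monoʳ-≤ (f x) (total≤total-filter f P? xs (h ∘ there))
  ... | no ¬p = ≤-trans (+-mono-≤ (h (here refl) ¬p) (total≤total-filter f P? xs (h ∘ there)))
                        (≤-reflexive (+-identityˡ _))

  -- With `f` the value, `g` the size and `d` a price per unit of size, this is the Lagrangian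
  -- splitting behind the fractional bound.
  total-surplus : (f g : Fin n → ℚ) (d : ℚ) (xs : List (Fin n)) →
                  total f xs ≡ total (λ i → f i - d * g i) xs + d * total g xs
  total-surplus f g d []       = solve 1 (λ d → con 0ℚ := con 0ℚ :+ d :* con 0ℚ) refl d
    where open +-*-Solver
  total-surplus f g d (x ∷ xs) = trans (cong (λ s → f x + s) (total-surplus f g d xs))
    (solve 5 (λ a b d r s → a :+ (r :+ d :* s) := ((a :- d :* b) :+ r) :+ d :* (b :+ s))
      refl (f x) (g x) d (total (λ i → f i - d * g i) xs) (total g xs))
    where open +-*-Solver

  elements-unique : ∀ S → Unique (elements {n} S)
  elements-unique S = Unique.filter⁺ _ (Unique.allFin⁺ n)

  module _ (I : Instance n) (t : Permutation′ n) where
    open Instance I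

    private
      infix 4 _⊳_ _⊳?_
      _⊳_ : Fin n → Fin n → Set
      _⊳_ = _≻_ I t

      _⊳?_ : ∀ i j → _
      _⊳?_ = _≻?_ I t

      d : Fin n → ℚ
      d = density I

    -- Comparing values through densities and sizes.

    v≡d*l : ∀ i → v i ≡ d i * l i
    v≡d*l i = sym (trans (*-assoc (v i) (1/ l i) (l i))
      (trans (cong (v i *_) (*-inverseˡ (l i))) (*-identityʳ (v i))))
      where instance _ = >-nonZero (l-pos i)

    l-nonNeg : ∀ i → 0ℚ ≤ l i
    l-nonNeg i = <⇒≤ (l-pos i)

    d-nonNeg : ∀ i → 0ℚ ≤ d i
    d-nonNeg i = *-cancelʳ-≤-pos (l i) {{positive (l-pos i)}} (begin
      0ℚ * l i  ≡⟨ *-zeroˡ (l i) ⟩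
      0ℚ        ≤⟨ v-nonNeg i ⟩
      v i       ≡⟨ v≡d*l i ⟩
      d i * l i ∎)
      where open ≤-Reasoning

    -- Together with `v≤d*l`, this settles the sign of the surplus of `i` at the price `d j`.
    d*l≤v : ∀ {i j} → d j ≤ d i → d j * l i ≤ v i
    d*l≤v {i} {j} dj≤di = begin
      d j * l i ≤⟨ *-monoʳ-≤-nonNeg (l i) {{nonNegative (l-nonNeg i)}} dj≤di ⟩
      d i * l i ≡⟨ v≡d*l i ⟨
      v i       ∎
      where open ≤-Reasoning

    v≤d*l : ∀ {i j} → d i ≤ d j → v i ≤ d j * l i
    v≤d*l {i} {j} di≤dj = begin
      v i       ≡⟨ v≡d*l i ⟩
      d i * l i ≤⟨ *-monoʳ-≤-nonNeg (l i) {{nonNegative (l-nonNeg i)}} di≤dj ⟩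
      d j * l i ∎
      where open ≤-Reasoning

    ⋫⇒d≤ : ∀ {i j} → ¬ i ⊳ j → d i ≤ d j
    ⋫⇒d≤ i⋫j = ≮⇒≥ (i⋫j ∘ inj₁)

    larger-denser⇒v≥ : ∀ {i j} → l j ≤ l i → ¬ j ⊳ i → v j ≤ v i
    larger-denser⇒v≥ {i} {j} lj≤li j⋫i = begin
      v j       ≤⟨ v≤d*l (⋫⇒d≤ j⋫i) ⟩
      d i * l j ≤⟨ *-monoˡ-≤-nonNeg (d i) {{nonNegative (d-nonNeg i)}} lj≤li ⟩
      d i * l i ≡⟨ v≡d*l i ⟨
      v i       ∎
      where open ≤-Reasoning

    ⊳-⋫-trans : ∀ {i j k} → i ⊳ j → ¬ k ⊳ j → i ⊳ k
    ⊳-⋫-trans {i} {j} {k} i⊳j k⋫j with ≻-cmp I t j k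
    ... | tri< j⊳k _ _   = ≻-trans I t i⊳j j⊳k
    ... | tri≈ _ refl _  = i⊳j
    ... | tri> _ _ k⊳j   = contradiction k⊳j k⋫j

    -- The candidates for a capacity, split into prefix and suffix.

    module _ (C : ℚ) where

      private
        D = candidates I t C
        fits? : Decidable (λ i → l i ≤ C)
        fits? i = l i ≤? C

      ∈-candidates⁺ : ∀ {i} → l i ≤ C → i ∈ D
      ∈-candidates⁺ {i} li≤C = ∈-resp-↭ (↭-sym (Sort.sort-↭ (≽-decTotalOrder I t) _))
        (∈-filter⁺ fits? (∈-allFin i) li≤C)

      ∈-candidates⁻ : ∀ {i} → i ∈ D → l i ≤ C
      ∈-candidates⁻ i∈ = proj₂ (∈-filter⁻ fits? {xs = allFin n}
        (∈-resp-↭ (Sort.sort-↭ (≽-decTotalOrder I t) _) i∈))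

      candidates-unique : Unique D
      candidates-unique = Unique-resp-↭ (↭-sym (Sort.sort-↭ (≽-decTotalOrder I t) _))
        (Unique.filter⁺ fits? (Unique.allFin⁺ n))

      candidates-sorted : AllPairs (DecTotalOrder._≤_ (≽-decTotalOrder I t)) D
      candidates-sorted = Linked⇒AllPairs (λ {i} {j} {k} → DecTotalOrder.trans (≽-decTotalOrder I t) {i} {j} {k})
        (Sort.sort-↗ (≽-decTotalOrder I t) _)

      module _ {P R : List (Fin n)} (D≡P++R : D ≡ P ++ R) where

        -- The split is arbitrary: besides the greedy prefix `P`, the proof also cuts behind the
        -- break item.
        prefix-⋫ : ∀ {x y} → x ∈ P → y ∈ R → ¬ y ⊳ x
        prefix-⋫ {x} {y} x∈ y∈ y⊳x
          with ≻-cmp I t x y | AllPairs-++⁻ P (subst (AllPairs _) D≡P++R candidates-sorted) x∈ y∈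
        ... | tri< _ _ y⋫x  | _         = y⋫x y⊳x
        ... | tri≈ _ _ y⋫x  | _         = y⋫x y⊳x
        ... | tri> x⋫y _ _  | inj₁ x⊳y  = x⋫y x⊳y
        ... | tri> _ x≢y _  | inj₂ x≡y  = x≢y x≡y

        ∉prefix⇒∈suffix : ∀ {x} → l x ≤ C → x ∉ P → x ∈ R
        ∉prefix⇒∈suffix lx≤C x∉P with ∈-++⁻ P (subst (_ ∈_) D≡P++R (∈-candidates⁺ lx≤C))
        ... | inj₁ x∈P = contradiction x∈P x∉P
        ... | inj₂ x∈R = x∈R

        prefix-⊳ : ∀ {x y} → x ∈ P → y ∉ P → l y ≤ C → x ⊳ y
        prefix-⊳ {x} {y} x∈ y∉ ly≤C with ≻-cmp I t x y
        ... | tri< x⊳y _ _  = x⊳y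
        ... | tri≈ _ refl _ = contradiction x∈ y∉
        ... | tri> _ _ y⊳x  = contradiction y⊳x (prefix-⋫ x∈ (∉prefix⇒∈suffix ly≤C y∉))

        prefix-unique : Unique P
        prefix-unique = AllPairs-++⁻ˡ P (subst Unique D≡P++R candidates-unique)

    -- The break item of the fractional relaxation, and the bound on the optimum.

    record Break (C : ℚ) (s : Fin n) : Set where
      field
        {P R}    : List (Fin n)
        split    : candidates I t C ≡ P ++ s ∷ R
        fits     : total l P ≤ C
        overflow : C < total l P + l s

      l≤C : l s ≤ C
      l≤C = ∈-candidates⁻ C (subst (s ∈_) (sym split) (∈-++⁺ʳ P (here refl)))

      ⊳⇒∈P : ∀ {i} → l i ≤ C → i ⊳ s → i ∈ P
      ⊳⇒∈P {i} li≤C i⊳s with i ∈? P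
      ... | yes i∈ = i∈
      ... | no i∉ with ∉prefix⇒∈suffix C split li≤C i∉
      ...   | here refl = contradiction i⊳s (λ { (inj₁ p) → <-irrefl refl p ; (inj₂ (_ , p)) → Fin.<-irrefl refl p })
      -- The cut is moved behind `s`, so that `s` becomes a prefix item and no item of `R` can be
      -- denser.
      ...   | there i∈R = contradiction i⊳s (prefix-⋫ C {P ++ [ s ]} (trans split (sym (List.++-assoc P [ s ] R)))
                            (∈-++⁺ʳ P (here refl)) i∈R)

      -- The fractional relaxation: every item of P has nonnegative surplus
      -- v − d(s) l, and every other candidate nonpositive surplus.

      optimum-bound : ∀ {T} → Unique T → total l T ≤ C → total v T ≤ total v P + v s
      optimum-bound {T} uT T-fits = begin
        total v T                                  ≡⟨ total-surplus v l (d s) T ⟩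
        total g T + d s * total l T                ≤⟨ +-mono-≤ gT≤gP dT≤ ⟩
        total g P + d s * (total l P + l s)        ≡⟨ solve 4 (λ g d p s → g :+ d :* (p :+ s) := (g :+ d :* p) :+ d :* s)
                                                       refl (total g P) (d s) (total l P) (l s) ⟩
        (total g P + d s * total l P) + d s * l s  ≡⟨ cong₂ _+_ (total-surplus v l (d s) P) (v≡d*l s) ⟨
        total v P + v s                            ∎
        where
        open ≤-Reasoning
        open +-*-Solver
        g : Fin n → ℚ
        g i = v i - d s * l i
        -- Any feasible `T` is no larger than `P` with `s` added, and the price `d s` is
        -- nonnegative.
        dT≤ : d s * total l T ≤ d s * (total l P + l s)
        dT≤ = *-monoˡ-≤-nonNeg (d s) {{nonNegative (d-nonNeg s)}} (≤-trans T-fits (<⇒≤ overflow))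
        outside-P : ∀ {i} → i ∈ T → i ∉ P → g i ≤ 0ℚ
        outside-P i∈ i∉ = p≤q⇒p-q≤0 (v≤d*l (⋫⇒d≤ λ i⊳s → i∉ (⊳⇒∈P li≤C i⊳s)))
          where li≤C = ≤-trans (term≤total l l-nonNeg i∈) T-fits
        inside-P : ∀ {i} → i ∈ P → 0ℚ ≤ g i
        inside-P i∈ = p≤q⇒0≤q-p (d*l≤v (⋫⇒d≤ (prefix-⋫ C split i∈ (here refl))))
        gT≤gP : total g T ≤ total g P
        gT≤gP = ≤-trans (total≤total-filter g (_∈? P) T outside-P)
          (total-mono-⊆ g (Unique.filter⁺ (_∈? P) uT) (λ i∈ → proj₂ (∈-filter⁻ (_∈? P) {xs = T} i∈)) inside-P)

    -- The possible results of MGreedy.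

    data Outcome (C : ℚ) : List (Fin n) ⊎ Fin n → Set where
      everything : total l (candidates I t C) ≤ C → Outcome C (inj₁ (candidates I t C))
      prefix     : ∀ {s} (b : Break C s) → v s ≤ total v (Break.P b) → Outcome C (inj₁ (Break.P b))
      swapped    : ∀ {s} (b : Break C s) → total v (Break.P b) < v s → Outcome C (inj₂ s)

    module _ {C : ℚ} (0≤C : 0ℚ ≤ C) where

      private
        D = candidates I t C
        k = prefixLength I t C D
        fitting? : Decidable (λ j → total l (take j D) ≤ C)
        fitting? j = total l (take j D) ≤? C

      greedy-fits : total l (take k D) ≤ C
      -- The maximum has default 0, the empty prefix, which fits because of `0≤C`; every other
      -- length passed the filter.
      greedy-fits = ℕExtrema.argmax-all (λ j → j) {P = λ j → total l (take j D) ≤ C}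
        {xs = fittingLengths I t C D} 0≤C
        (All.tabulate λ m → proj₂ (∈-filter⁻ fitting? {xs = List.upTo _} m))

      -- If `s` fitted as well, `suc k` would be a fitting length, against the maximality of `k`.
      -- The tested lengths go up to `length D` inclusive, and a nonempty `drop k D` puts `suc k` in
      -- that range.
      greedy-overflow : ∀ {s R} → drop k D ≡ s ∷ R → C < total l (take k D) + l s
      greedy-overflow {s} eq = ≰⇒> λ ≤C →
        let e , k< = drop≡∷⇒take-suc k D eq
            more   = subst (_≤ C) (sym (trans (cong (total l) e) (trans (total-++ l (take k D))
                       (cong (λ q → total l (take k D) + q) (+-identityʳ (l s)))))) ≤C
        in ℕ.1+n≰n (All.lookup (ℕExtrema.xs≤max 0 (fittingLengths I t C D))
             (∈-filter⁺ fitting? (∈-upTo⁺ (ℕ.s≤s k<)) more))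

      greedy-break : ∀ {s R} → drop k D ≡ s ∷ R → Break C s
      greedy-break {s} eq = record
        { P        = take k D
        ; split    = trans (sym (List.take++drop≡id k D)) (cong (take k D ++_) eq)
        ; fits     = greedy-fits
        ; overflow = greedy-overflow eq
        }

      outcome : Outcome C (mgreedy I t C)
      outcome with drop k D in eq
      ... | [] = subst (Outcome C ∘ inj₁) (sym P≡D) (everything (subst (λ X → total l X ≤ C) P≡D greedy-fits))
        where
        P≡D : take k D ≡ D
        P≡D = trans (sym (List.++-identityʳ _))
          (trans (cong (take k D ++_) (sym eq)) (List.take++drop≡id k D))
      ... | s ∷ R with v s ≤? total v (take k D)
      ...   | yes v≤ = prefix (greedy-break eq) v≤
      ...   | no v≰ = swapped (greedy-break eq) (≰⇒> v≰)

    -- `Outcome` is indexed by the result of MGreedy, so the index `inj₂ s` leaves only `swapped`.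
    swap⇒break : ∀ {C s} → 0ℚ ≤ C → IsSwapFor I t C s → ∃ λ (b : Break C s) → total v (Break.P b) < v s
    swap⇒break 0≤C sw with subst (Outcome _) sw (outcome 0≤C)
    ... | swapped b v< = b , v<

    -- The domination invariant and its effect on packings.

    record Dominates (x : Fin n) (Π : List (Fin n)) : Set where
      constructor dominates
      field
        denser : total v (filter (_⊳? x) Π) ≤ v x
        swaps  : All (λ y → IsSwap I t y → v y ≤ v x) Π

    data Layered : List (Fin n) → Set where
      []  : Layered []
      _∷_ : ∀ {x Π} → Dominates x Π → Layered Π → Layered (x ∷ Π)

    -- `S` stands for membership in the greedy prefix. The density hypothesis concerns only
    -- outsiders `y` that fit the remaining capacity, so it survives the recursion, where the
    -- capacity only shrinks.
    packing≥prefix : ∀ {S : Fin n → Set} (S? : Decidable S) {Π} C → Layered Π →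
                     (∀ {x y} → S x → ¬ S y → l y ≤ C → x ⊳ y) →
                     total l (filter S? Π) ≤ C →
                     total v (filter S? Π) ≤ total v (packing I Π C)
    packing≥prefix S? C [] _ _ = ≤-refl
    packing≥prefix {S} S? {x ∷ Π} C (dom ∷ lay) S⊳ fits with S? x | l x ≤? C
    ... | yes _ | yes lx≤C = +-monoʳ-≤ (v x) (packing≥prefix S? (C - l x) lay
            (λ Sx ¬Sy ly≤ → S⊳ Sx ¬Sy (≤-trans ly≤ (0≤q⇒p-q≤p C (l-nonNeg x))))
            (p+q≤r⇒q≤r-p (l x) _ fits))
    -- All remaining items of `S` fit together, so none of them can be rejected.
    ... | yes _ | no lx≰C = contradiction
            (≤-trans (p≤p+q (l x) (total-nonNeg l (filter S? Π) (λ _ → l-nonNeg _))) fits) lx≰C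
    -- `x` is the first packed outsider. It fits, so the items of `S` still to come are denser than
    -- `x`, and `denser` charges them all to `x`; no recursion is required.
    ... | no ¬Sx | yes lx≤C = begin
            total v (filter S? Π)           ≤⟨ total-filter-mono v v-nonNeg S? (_⊳? x) (λ Sy → S⊳ Sy ¬Sx lx≤C) Π ⟩
            total v (filter (_⊳? x) Π)      ≤⟨ Dominates.denser dom ⟩
            v x                             ≤⟨ p≤p+q (v x) (total-nonNeg v (packing I Π (C - l x)) (λ _ → v-nonNeg _)) ⟩
            v x + total v (packing I Π (C - l x)) ∎
      where open ≤-Reasoning
    ... | no _ | no _ = packing≥prefix S? C lay S⊳ fits

    -- Until something is packed the remaining capacity is the full `C`, so `s` would be accepted
    -- when reached. The first packed item is therefore `s` or precedes it, and then `swaps`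
    -- applies.
    packing≥swap : ∀ {Π C s} → Layered Π → s ∈ Π → l s ≤ C → IsSwap I t s → v s ≤ total v (packing I Π C)
    packing≥swap {x ∷ Π} {C} (dom ∷ lay) s∈ ls≤C sw with l x ≤? C
    packing≥swap {x ∷ Π} {C} (dom ∷ lay) s∈ ls≤C sw | yes _ =
      ≤-trans (v≤ s∈ sw) (p≤p+q (v x) (total-nonNeg v (packing I Π (C - l x)) (λ _ → v-nonNeg _)))
      where
      v≤ : ∀ {s} → s ∈ x ∷ Π → IsSwap I t s → v s ≤ v x
      v≤ (here refl) _  = ≤-refl
      v≤ (there s∈)  sw = All.lookup (Dominates.swaps dom) s∈ sw
    packing≥swap (dom ∷ lay) (here refl) ls≤C sw | no lx≰C = contradiction ls≤C lx≰C
    packing≥swap (dom ∷ lay) (there s∈)  ls≤C sw | no _    = packing≥swap lay s∈ ls≤C sw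

    -- Insertion preserves the invariant.

    swap-dominates : ∀ {i Π} → IsSwap I t i → Unique Π → All (λ y → l y ≤ l i) Π → Dominates i Π
    swap-dominates {i} {Π} (C , 0≤C , sw) uΠ l≤ =
      dominates denser (All.tabulate λ y∈ _ → v≤ y∈)
      where
      b  = proj₁ (swap⇒break 0≤C sw)
      v< = proj₂ (swap⇒break 0≤C sw)
      open Break b
      -- `C` is the capacity for which `i` is a swap item. Items of `Π` are no larger than `i`,
      -- hence fit `C`; the denser ones thus lie in `P`, whose value is below `v i`.
      denser : total v (filter (_⊳? i) Π) ≤ v i
      denser = ≤-trans (total-mono-⊆ v (Unique.filter⁺ (_⊳? i) uΠ)
        (λ y∈ → let y∈Π , y⊳i = ∈-filter⁻ (_⊳? i) {xs = Π} y∈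
                in ⊳⇒∈P (≤-trans (All.lookup l≤ y∈Π) l≤C) y⊳i)
        (λ _ → v-nonNeg _)) (<⇒≤ v<)
      -- The bound holds for every `y`, swap item or not: a denser one is a term of the sum just
      -- bounded, and any other is neither larger nor denser than `i`.
      v≤ : ∀ {y} → y ∈ Π → v y ≤ v i
      v≤ {y} y∈ with y ⊳? i
      ... | yes y⊳i = ≤-trans (term≤total v v-nonNeg (∈-filter⁺ (_⊳? i) y∈ y⊳i)) denser
      ... | no y⋫i  = larger-denser⇒v≥ (All.lookup l≤ y∈) y⋫i

    -- Performs the case split on `isSwap?` once, for the permutation property and the invariant
    -- alike.
    insert-cases : (Q : List (Fin n) → Set) (Π : List (Fin n)) (i : Fin n) →
                   (IsSwap I t i → Q (i ∷ Π)) →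
                   (¬ IsSwap I t i → Q (takeWhile (_⊳? i) Π ++ i ∷ dropWhile (_⊳? i) Π)) →
                   Q (insert I t Π i)
    insert-cases Q Π i front behind with isSwap? I t i
    ... | yes sw = front sw
    ... | no ¬sw = behind ¬sw

    insert-↭ : ∀ Π i → insert I t Π i ↭ i ∷ Π
    insert-↭ Π i = insert-cases (_↭ i ∷ Π) Π i (λ _ → ↭-refl) (λ _ → takeWhile-insert-↭ (_⊳? i) Π)

    -- A non-swap item is dominating because the item f right behind it is:
    -- f is neither larger nor denser, and whatever is denser than i is denser than f.

    nonswap-layered : ∀ {i Π} (P? : Decidable (_⊳ i)) → ¬ IsSwap I t i → All (λ y → l y ≤ l i) Π → Layered Π →
                      Layered (takeWhile P? Π ++ i ∷ dropWhile P? Π)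
    nonswap-layered {i} P? ¬sw [] [] = dominates (v-nonNeg i) [] ∷ []
    nonswap-layered {i} {x ∷ Π} P? ¬sw (lx≤ ∷ l≤) lay@(dominates denser swaps ∷ layΠ) with P? x
    -- `x` stays in front of `i`. The new item changes neither condition on `x`: it is not denser
    -- than `x`, and it is not a swap item.
    ... | yes x⊳i = dominates denser′ (All-resp-↭ (↭-sym p) ((λ sw → contradiction sw ¬sw) ∷ swaps))
                      ∷ nonswap-layered P? ¬sw l≤ layΠ
      where
      open ≤-Reasoning
      i⋫x : ¬ i ⊳ x
      i⋫x with ≻-cmp I t x i
      ... | tri< _ _ i⋫x = i⋫x
      ... | tri≈ _ _ i⋫x = i⋫x
      ... | tri> x⋫i _ _ = contradiction x⊳i x⋫i
      p : takeWhile P? Π ++ i ∷ dropWhile P? Π ↭ i ∷ Π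
      p = takeWhile-insert-↭ P? Π
      denser′ : total v (filter (_⊳? x) (takeWhile P? Π ++ i ∷ dropWhile P? Π)) ≤ v x
      denser′ = begin
        total v (filter (_⊳? x) (takeWhile P? Π ++ i ∷ dropWhile P? Π)) ≡⟨ total-↭ v (filter-↭ (_⊳? x) p) ⟩
        total v (filter (_⊳? x) (i ∷ Π)) ≡⟨ cong (total v) (List.filter-reject (_⊳? x) i⋫x) ⟩
        total v (filter (_⊳? x) Π)       ≤⟨ denser ⟩
        v x                              ∎
    ... | no x⋫i = dominates denser′ (All.map (λ y≤x sw → ≤-trans (y≤x sw) vx≤vi) ((λ _ → ≤-refl) ∷ swaps)) ∷ lay
      where
      open ≤-Reasoning
      vx≤vi : v x ≤ v i
      vx≤vi = larger-denser⇒v≥ lx≤ x⋫i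
      denser′ : total v (filter (_⊳? i) (x ∷ Π)) ≤ v i
      denser′ = begin
        total v (filter (_⊳? i) (x ∷ Π)) ≡⟨ cong (total v) (List.filter-reject (_⊳? i) x⋫i) ⟩
        total v (filter (_⊳? i) Π)       ≤⟨ total-filter-mono v v-nonNeg (_⊳? i) (_⊳? x) (λ y⊳i → ⊳-⋫-trans y⊳i x⋫i) Π ⟩
        total v (filter (_⊳? x) Π)       ≤⟨ denser ⟩
        v x                              ≤⟨ vx≤vi ⟩
        v i                              ∎

    insert-layered : ∀ {i Π} → Unique Π → All (λ y → l y ≤ l i) Π → Layered Π → Layered (insert I t Π i)
    insert-layered {i} {Π} uΠ l≤ lay = insert-cases Layered Π i
      (λ sw → swap-dominates sw uΠ l≤ ∷ lay) (λ ¬sw → nonswap-layered (_⊳? i) ¬sw l≤ lay)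

    -- Induction over the unread items `L`. That `Π ++ L` lists every item once gives the policy at
    -- the end and the uniqueness of `Π` on the way; that `Π` holds nothing larger than an unread
    -- item is what each insertion needs.
    foldl-insert : ∀ Π L → Layered Π → Π ++ L ↭ allFin n → AllPairs (λ i j → l i ≤ l j) L →
                   All (λ i → All (λ y → l y ≤ l i) Π) L →
                   foldl (insert I t) Π L ↭ allFin n × Layered (foldl (insert I t) Π L)
    foldl-insert Π [] lay p _ _ = ↭-trans (↭-sym (++-identityʳ Π)) p , lay
    foldl-insert Π (i ∷ L) lay p (i≤ ∷ sorted) (Π≤i ∷ Π≤) =
      foldl-insert (insert I t Π i) L (insert-layered uΠ Π≤i lay)
        (↭-trans (++⁺ʳ L (insert-↭ Π i)) (↭-trans (↭-sym (shift i Π L)) p)) sorted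
        (All.zipWith (λ (li≤ , Π≤) → All-resp-↭ (↭-sym (insert-↭ Π i)) (li≤ ∷ Π≤)) (i≤ , Π≤))
      where
      uΠ : Unique Π
      uΠ = AllPairs-++⁻ˡ Π (Unique-resp-↭ (↭-sym p) (Unique.allFin⁺ n))

    -- From the invariant to robustness factor 2.

    layered⇒robust : ∀ {Π} → Π ↭ allFin n → Layered Π → Robust I (+ 2 / 1) Π
    layered⇒robust {Π} p lay C 0≤C S opt = ≤-trans bound
      -- `+ 2 / 1` and `1ℚ + 1ℚ` evaluate to the same rational, so the factor distributes into
      -- `w + w`.
      (≤-reflexive (sym (trans (*-distribʳ-+ w 1ℚ 1ℚ) (cong₂ _+_ (*-identityˡ w) (*-identityˡ w)))))
      where
      open ≤-Reasoning
      T = elements S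
      w = total v (packing I Π C)
      T-fits : total l T ≤ C
      T-fits = IsOpt.fits opt
      ∈Π : ∀ i → i ∈ Π
      ∈Π i = ∈-resp-↭ (↭-sym p) (∈-allFin i)
      uΠ : Unique Π
      uΠ = Unique-resp-↭ (↭-sym p) (Unique.allFin⁺ n)
      -- `P` and its items in the order of `Π` are compared by inclusion in both directions: one for
      -- the values, the other for the sizes.
      prefix≤ : ∀ P {R} → candidates I t C ≡ P ++ R → total l P ≤ C → total v P ≤ w
      prefix≤ P split fits = begin
        total v P                    ≤⟨ total-mono-⊆ v (prefix-unique C split) (λ i∈ → ∈-filter⁺ (_∈? P) (∈Π _) i∈) (λ _ → v-nonNeg _) ⟩
        total v (filter (_∈? P) Π)   ≤⟨ packing≥prefix (_∈? P) C lay (prefix-⊳ C split)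
                                          (≤-trans (total-mono-⊆ l (Unique.filter⁺ (_∈? P) uΠ)
                                            (λ i∈ → proj₂ (∈-filter⁻ (_∈? P) {xs = Π} i∈)) (λ _ → l-nonNeg _)) fits) ⟩
        w                            ∎
      bound : total v T ≤ w + w
      bound with mgreedy I t C in sw | outcome 0≤C
      ... | _ | everything fits = begin
        total v T ≤⟨ total-mono-⊆ v (elements-unique S)
                       (λ i∈ → ∈-candidates⁺ C (≤-trans (term≤total l l-nonNeg i∈) T-fits)) (λ _ → v-nonNeg _) ⟩
        total v (candidates I t C) ≤⟨ prefix≤ (candidates I t C) (sym (List.++-identityʳ _)) fits ⟩
        w         ≤⟨ p≤p+q w (total-nonNeg v (packing I Π C) (λ _ → v-nonNeg _)) ⟩
        w + w     ∎
      ... | _ | prefix {s} b vs≤ = begin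
        total v T                     ≤⟨ Break.optimum-bound b (elements-unique S) T-fits ⟩
        total v (Break.P b) + v s     ≤⟨ +-mono-≤ P≤ (≤-trans vs≤ P≤) ⟩
        w + w                         ∎
        where P≤ = prefix≤ (Break.P b) (Break.split b) (Break.fits b)
      -- The equation `sw` makes the present capacity itself the witness that `s` is a swap item.
      ... | _ | swapped {s} b _ = begin
        total v T                     ≤⟨ Break.optimum-bound b (elements-unique S) T-fits ⟩
        total v (Break.P b) + v s     ≤⟨ +-mono-≤ (prefix≤ (Break.P b) (Break.split b) (Break.fits b))
                                           (packing≥swap lay (∈Π s) (Break.l≤C b) (C , 0≤C , sw)) ⟩
        w + w                         ∎

theorem2 : ∀ {n : ℕ} (I : Instance n) (t : Permutation′ n) (L : List (Fin n)) →
    L ↭ allFin n → BySize I L →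
    IsPolicy I (universal I t L) × Robust I (+ 2 / 1) (universal I t L)
theorem2 I t L L↭ bySize =
  let policy , lay = foldl-insert I t [] L [] L↭ (Linked⇒AllPairs ≤-trans bySize) (All.tabulate λ _ → [])
  in policy , layered⇒robust I t policy lay
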